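{- The suspension functor $\Sigma:\mathcal U_\ast\to\mathcal U_\ast$ on the wild category of pointed types preserves colimits: for every graph $\Gamma$, every $\Gamma$-shaped diagram $F$ in $\mathcal U_\ast$ and every colimiting cocone $\mathcal K$ under $F$, the cocone $\Sigma(\mathcal K)$ under $\Sigma(F)$ is colimiting.
   Context: Everything is inside Book HoTT with pushout types (suspensions have definitional $\beta$-rules on points and typal $\beta$-rules on paths). $p\cdot q$ is path concatenation, $\mathsf{ap}_f$ the action of $f$ on paths. $\mathcal U_\ast$ is the wild category of pointed types in the universe $\mathcal U$, with hom types the types of pointed maps $(f,f_0)$, $f_0:f(x_0)=y_0$, composition $(g,g_0)\circ(f,f_0)=(g\circ f,\mathsf{ap}_g(f_0)\cdot g_0)$, and the evident identities, unit laws and associativity law $\mathsf{assoc}(f,g,h):(f\circ g)\circ h=f\circ(g\circ h)$. (A wild category requires only this data; hom types need not be sets.) A wild functor $L$ consists of functions on objects and morphisms with paths $L_\circ(g,f):L(g)\circ L(f)=L(g\circ f)$ and $L_{\mathsf{id}}(X):\mathsf{id}_{L(X)}=L(\mathsf{id}_X)$. Graph $\Gamma$: a type $\Gamma_0:\mathcal U$ of vertices and a family $\Gamma_1:\Gamma_0\to\Gamma_0\to\mathcal U$ of edges. Diagram $F$: objects $F_i$ and morphisms $F_{i,j,g}:\mathsf{hom}(F_i,F_j)$ for $g:\Gamma_1(i,j)$. Cocone $(C,r,K)$ under $F$: an object $C$, $r_i:\mathsf{hom}(F_i,C)$, paths $K_{i,j,g}:r_j\circ F_{i,j,g}=r_i$.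 It is colimiting if for every object $X$ the map $\mathsf{hom}(C,X)\to\sum_{s:\prod_i\mathsf{hom}(F_i,X)}\prod_{i,j,g}s_j\circ F_{i,j,g}=s_i$, $f\mapsto(\lambda i.f\circ r_i,\ \mathsf{assoc}(f,r_j,F_{i,j,g})\cdot\mathsf{ap}_{f\circ- }(K_{i,j,g}))$ is an equivalence. For a wild functor $L$, $L(F)$ is the image diagram and $L(C,r,K):=(L(C),L(r_i),L_\circ(r_j,F_{i,j,g})\cdot\mathsf{ap}_L(K_{i,j,g}))$. $\Sigma(X)$ is the suspension of the underlying type, with points $\mathsf N$ (basepoint), $\mathsf S$ and paths $\mathsf{glue}(x):\mathsf N=\mathsf S$. For a pointed map $f$, $\Sigma(f)$ is defined by recursion with $\mathsf N\mapsto\mathsf N$, $\mathsf S\mapsto\mathsf S$ and $\beta_{\Sigma(f)}(x):\mathsf{ap}_{\Sigma(f)}(\mathsf{glue}(x))=\mathsf{glue}(f(x))$; it preserves the basepoint trivially. The composition law $\Sigma_\circ(s,r):\Sigma(s)\circ\Sigma(r)=\Sigma(s\circ r)$ is the path of pointed maps whose underlying homotopy is defined by $\Sigma$-induction, being $\mathsf{refl}$ at $\mathsf N$ and $\mathsf S$ and given on $\mathsf{glue}(x)$ by the identification of $\mathsf{ap}_{\Sigma(s)\circ\Sigma(r)}(\mathsf{glue}(x))$ with $\mathsf{ap}_{\Sigma(s\circ r)}(\mathsf{glue}(x))$ built from $\beta_{\Sigma(r)}(x)$, $\beta_{\Sigma(s)}(r(x))$, $\beta_{\Sigma(s\circ r)}(x)$;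 its basepoint component is trivial. -}

{-# OPTIONS --safe --without-K #-}

-- Identity types are the inductive _≡_, without K.  In the library's names,
-- trans p q is p · q, cong f is ap_f, subst P is transport along P, and dcong is
-- the dependent ap.
--
-- The features of Book HoTT used here that are not derivable in this theory,
-- function extensionality (FunExt) and suspension types (Suspensions), are types
-- of data to be taken as hypotheses.

module Defs where

open import Data.Product using (Σ; Σ-syntax; _,_; proj₁; proj₂)
open import Function.Base using (_∘_; id)
open import Level using (Level; suc; _⊔_)
open import Relation.Binary.PropositionalEquality
  using (_≡_; refl; sym; trans; cong; cong-app; subst; dcong)
open import Relation.Binary.PropositionalEquality.Properties
  using (trans-assoc; trans-reflʳ; trans-symˡ; cong-id; cong-∘)

private
  variable
    a b ℓ o h : Level

-- Separate left and right inverses (bi-invertibility), so that this is a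
-- proposition and not merely the data of a quasi-inverse.
record IsEquiv {A : Set a} {B : Set b} (f : A → B) : Set (a ⊔ b) where
  field
    section          : B → A
    section-inverse  : ∀ y → f (section y) ≡ y
    retraction         : B → A
    retraction-inverse : ∀ x → retraction (f x) ≡ x

FunExt : (ℓ : Level) → Set (suc ℓ)
FunExt ℓ = (A : Set ℓ) (B : A → Set ℓ) (f g : (x : A) → B x) →
           IsEquiv (cong-app {f = f} {g = g})

module _ (fe : FunExt ℓ) {A B : Set ℓ} {f g : A → B} where

  funext : (∀ x → f x ≡ g x) → f ≡ g
  funext = IsEquiv.section (fe A (λ _ → B) f g)

  funext-β : (H : ∀ x → f x ≡ g x) → cong-app (funext H) ≡ H
  funext-β = IsEquiv.section-inverse (fe A (λ _ → B) f g)

record WildCategory (o h : Level) : Set (suc (o ⊔ h)) where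
  infixr 9 _⊚_
  field
    Obj   : Set o
    Hom   : Obj → Obj → Set h
    idn   : (X : Obj) → Hom X X
    _⊚_   : {X Y Z : Obj} → Hom Y Z → Hom X Y → Hom X Z
    unitˡ : {X Y : Obj} (f : Hom X Y) → idn Y ⊚ f ≡ f
    unitʳ : {X Y : Obj} (f : Hom X Y) → f ⊚ idn X ≡ f
    assoc : {W X Y Z : Obj} (f : Hom Y Z) (g : Hom X Y) (k : Hom W X) →
            (f ⊚ g) ⊚ k ≡ f ⊚ (g ⊚ k)

record WildFunctor {o h o′ h′ : Level}
                   (C : WildCategory o h) (D : WildCategory o′ h′) :
                   Set (o ⊔ h ⊔ o′ ⊔ h′) where
  private
    module C = WildCategory C
    module D = WildCategory D
  field
    obj     : C.Obj → D.Obj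
    hom     : {X Y : C.Obj} → C.Hom X Y → D.Hom (obj X) (obj Y)
    hom-∘   : {X Y Z : C.Obj} (g : C.Hom Y Z) (f : C.Hom X Y) →
              hom g D.⊚ hom f ≡ hom (g C.⊚ f)
    hom-idn : (X : C.Obj) → D.idn (obj X) ≡ hom (C.idn X)

record Graph (ℓ : Level) : Set (suc ℓ) where
  field
    Vertex : Set ℓ
    Edge   : Vertex → Vertex → Set ℓ

module _ (Γ : Graph ℓ) (C : WildCategory o h) where
  open Graph Γ
  open WildCategory C

  record Diagram : Set (ℓ ⊔ o ⊔ h) where
    field
      obj : Vertex → Obj
      hom : (i j : Vertex) → Edge i j → Hom (obj i) (obj j)

module _ {Γ : Graph ℓ} {C : WildCategory o h} (F : Diagram Γ C) where
  open Graph Γ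
  open WildCategory C
  private module F = Diagram F

  CoconeOn : Obj → Set (ℓ ⊔ h)
  CoconeOn X = Σ[ s ∈ ((i : Vertex) → Hom (F.obj i) X) ]
               ((i j : Vertex) (e : Edge i j) → s j ⊚ F.hom i j e ≡ s i)

  record Cocone : Set (ℓ ⊔ o ⊔ h) where
    field
      tip  : Obj
      legs : (i : Vertex) → Hom (F.obj i) tip
      comm : (i j : Vertex) (e : Edge i j) → legs j ⊚ F.hom i j e ≡ legs i

  module _ (K : Cocone) where
    open Cocone K

    postcompose : (X : Obj) → Hom tip X → CoconeOn X
    postcompose X f =
      (λ i → f ⊚ legs i) ,
      (λ i j e → trans (assoc f (legs j) (F.hom i j e))
                       (cong (f ⊚_) (comm i j e)))

    IsColimiting : Set (ℓ ⊔ o ⊔ h)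
    IsColimiting = (X : Obj) → IsEquiv (postcompose X)

module _ {o′ h′ : Level} {Γ : Graph ℓ}
         {C : WildCategory o h} {D : WildCategory o′ h′}
         (L : WildFunctor C D) where
  private module L = WildFunctor L

  mapDiagram : Diagram Γ C → Diagram Γ D
  mapDiagram F = record
    { obj = λ i → L.obj (Diagram.obj F i)
    ; hom = λ i j e → L.hom (Diagram.hom F i j e)
    }

  mapCocone : {F : Diagram Γ C} → Cocone F → Cocone (mapDiagram F)
  mapCocone {F} K = record
    { tip  = L.obj tip
    ; legs = λ i → L.hom (legs i)
    ; comm = λ i j e → trans (L.hom-∘ (legs j) (Diagram.hom F i j e))
                             (cong L.hom (comm i j e))
    }
    where open Cocone K

Pointed : (ℓ : Level) → Set (suc ℓ)
Pointed ℓ = Σ[ A ∈ Set ℓ ] A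

infixr 0 _→∗_
_→∗_ : Pointed ℓ → Pointed ℓ → Set ℓ
(A , x₀) →∗ (B , y₀) = Σ[ f ∈ (A → B) ] f x₀ ≡ y₀

id∗ : (X : Pointed ℓ) → X →∗ X
id∗ X = id , refl

infixr 9 _∘∗_
_∘∗_ : {X Y Z : Pointed ℓ} → (Y →∗ Z) → (X →∗ Y) → (X →∗ Z)
(g , g₀) ∘∗ (f , f₀) = g ∘ f , trans (cong g f₀) g₀

assoc-base : {A B C : Set ℓ} (f : B → C) (g : A → B)
             {x y : A} {y′ : B} {z : C}
             (k₀ : x ≡ y) (g₀ : g y ≡ y′) (f₀ : f y′ ≡ z) →
             trans (cong (f ∘ g) k₀) (trans (cong f g₀) f₀) ≡
             trans (cong f (trans (cong g k₀) g₀)) f₀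
assoc-base f g refl g₀ f₀ = refl

-- In all three laws the underlying functions agree definitionally; only the
-- basepoint components have to be identified.
𝓤∗ : (ℓ : Level) → WildCategory (suc ℓ) ℓ
𝓤∗ ℓ = record
  { Obj   = Pointed ℓ
  ; Hom   = _→∗_
  ; idn   = id∗
  ; _⊚_   = _∘∗_
  ; unitˡ = λ (f , f₀) → cong (f ,_) (trans (trans-reflʳ (cong id f₀)) (cong-id f₀))
  ; unitʳ = λ _ → refl
  ; assoc = λ (f , f₀) (g , g₀) (k , k₀) →
              cong ((f ∘ g ∘ k) ,_) (assoc-base f g k₀ g₀ f₀)
  }

pointed-≡ : {X Y : Pointed ℓ} {f g : proj₁ X → proj₁ Y}
            {f₀ : f (proj₂ X) ≡ proj₂ Y} {g₀ : g (proj₂ X) ≡ proj₂ Y}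
            (p : f ≡ g) → f₀ ≡ trans (cong-app p (proj₂ X)) g₀ →
            _≡_ {A = X →∗ Y} (f , f₀) (g , g₀)
pointed-≡ refl q = cong (_ ,_) q

pointed-funext : FunExt ℓ → {X Y : Pointed ℓ} {f g : X →∗ Y}
                 (H : ∀ x → proj₁ f x ≡ proj₁ g x) →
                 proj₂ f ≡ trans (H (proj₂ X)) (proj₂ g) → f ≡ g
pointed-funext fe {X} {f = f} {g = g} H H₀ = pointed-≡ (funext fe H)
  (trans H₀ (cong (λ K → trans (K (proj₂ X)) (proj₂ g)) (sym (funext-β fe H))))

--        p
--    x -----> y
--  l |        | r
--    v        v
--    z -----> w
--        q
record Square {A : Set a} {x y z w : A}
              (p : x ≡ y) (q : z ≡ w) (l : x ≡ z) (r : y ≡ w) : Set a where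
  constructor square
  field
    commutes : trans p r ≡ trans l q

module _ {A : Set a} where

  infixl 5 _∙v_
  _∙v_ : {x y z w u v : A} {p : x ≡ y} {q : z ≡ w} {s : u ≡ v}
         {l : x ≡ z} {r : y ≡ w} {l′ : z ≡ u} {r′ : w ≡ v} →
         Square p q l r → Square q s l′ r′ →
         Square p s (trans l l′) (trans r r′)
  _∙v_ {p = p} {l = refl} {r = refl} {r′ = r′} (square α) (square β) =
    square (trans (cong (λ t → trans t r′) (trans (sym (trans-reflʳ p)) α)) β)

  symv : {x y z w : A} {p : x ≡ y} {q : z ≡ w} {l : x ≡ z} {r : y ≡ w} →
         Square p q l r → Square q p (sym l) (sym r)
  symv {p = p} {q} {l = refl} {r = refl} (square α) =
    square (trans (trans-reflʳ q) (trans (sym α) (trans-reflʳ p)))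

  replace-top : {x y z w : A} {p p′ : x ≡ y} {q : z ≡ w} {l : x ≡ z} {r : y ≡ w} →
                p′ ≡ p → Square p q l r → Square p′ q l r
  replace-top {r = r} e (square α) = square (trans (cong (λ t → trans t r) e) α)

cong-square : {A : Set a} {B : Set b} (f : A → B) {x y z w : A}
              {p : x ≡ y} {q : z ≡ w} {l : x ≡ z} {r : y ≡ w} →
              Square p q l r →
              Square (cong f p) (cong f q) (cong f l) (cong f r)
cong-square f {p = p} {l = refl} {r = refl} (square α) =
  square (trans (trans-reflʳ (cong f p))
                (cong (cong f) (trans (sym (trans-reflʳ p)) α)))

square→subst : {A : Set a} {B : Set b} (f g : A → B) {x y : A} (p : x ≡ y)
               {hx : f x ≡ g x} {hy : f y ≡ g y} →
               Square (cong f p) (cong g p) hx hy →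
               subst (λ z → f z ≡ g z) p hx ≡ hy
square→subst f g refl {hx = hx} (square α) = trans (sym (trans-reflʳ hx)) (sym α)

-- The β-rules at the points are typal, because a definitional equality cannot
-- be a hypothesis.  When they hold definitionally, ind-N and ind-S are refl and
-- ind-glue reads dcong (ind P n s g) (glue x) ≡ g x, up to the unit laws.
-- Induction is only required for families in the same universe.
record Suspensions (ℓ : Level) : Set (suc ℓ) where
  field
    Susp : Set ℓ → Set ℓ
    N S  : {A : Set ℓ} → Susp A
    glue : {A : Set ℓ} → A → N {A} ≡ S {A}
    ind  : {A : Set ℓ} (P : Susp A → Set ℓ) (n : P N) (s : P S) →
           (∀ x → subst P (glue x) n ≡ s) → ∀ z → P z
    ind-N : {A : Set ℓ} (P : Susp A → Set ℓ) (n : P N) (s : P S)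
            (g : ∀ x → subst P (glue x) n ≡ s) → ind P n s g N ≡ n
    ind-S : {A : Set ℓ} (P : Susp A → Set ℓ) (n : P N) (s : P S)
            (g : ∀ x → subst P (glue x) n ≡ s) → ind P n s g S ≡ s
    ind-glue : {A : Set ℓ} (P : Susp A → Set ℓ) (n : P N) (s : P S)
               (g : ∀ x → subst P (glue x) n ≡ s) (x : A) →
               trans (dcong (ind P n s g) (glue x)) (ind-S P n s g) ≡
               trans (cong (subst P (glue x)) (ind-N P n s g)) (g x)

subst-constant : {A : Set a} {B : Set b} {x y : A} (p : x ≡ y) (c : B) →
                 subst (λ _ → B) p c ≡ c
subst-constant refl c = refl

constant-square : {A : Set a} {B : Set b} (f : A → B) {x y : A} (p : x ≡ y)
                  {n s : B} (βx : f x ≡ n) (βy : f y ≡ s) (q : n ≡ s) →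
                  trans (dcong f p) βy ≡
                  trans (cong (subst (λ _ → B) p) βx) (trans (subst-constant p n) q) →
                  Square (cong f p) q βx βy
constant-square f refl refl βy q α = square α

module SuspensionRec (su : Suspensions ℓ) where
  open Suspensions su

  module _ {A B : Set ℓ} (n s : B) (g : A → n ≡ s) where

    private
      g′ : ∀ x → subst (λ _ → B) (glue x) n ≡ s
      g′ x = trans (subst-constant (glue x) n) (g x)

    rec : Susp A → B
    rec = ind (λ _ → B) n s g′

    rec-N : rec N ≡ n
    rec-N = ind-N (λ _ → B) n s g′

    rec-S : rec S ≡ s
    rec-S = ind-S (λ _ → B) n s g′

    rec-glue : ∀ x → Square (cong rec (glue x)) (g x) rec-N rec-S
    rec-glue x = constant-square rec (glue x) rec-N rec-S (g x)
                   (ind-glue (λ _ → B) n s g′ x)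

module Suspension (fe : FunExt ℓ) (su : Suspensions ℓ) where
  open Suspensions su
  open SuspensionRec su

  Susp∗ : Pointed ℓ → Pointed ℓ
  Susp∗ (A , _) = Susp A , N

  module _ {A B : Set ℓ} (f : A → B) where

    map : Susp A → Susp B
    map = rec N S (glue ∘ f)

    map-N : map N ≡ N
    map-N = rec-N N S (glue ∘ f)

    map-S : map S ≡ S
    map-S = rec-S N S (glue ∘ f)

    map-glue : ∀ x → Square (cong map (glue x)) (glue (f x)) map-N map-S
    map-glue = rec-glue N S (glue ∘ f)

  -- With definitional β-rules the basepoint path is refl.
  map∗ : {X Y : Pointed ℓ} → X →∗ Y → Susp∗ X →∗ Susp∗ Y
  map∗ (f , _) = map f , map-N f

  module _ {A B : Set ℓ} (u v : Susp A → B) (hN : u N ≡ v N) (hS : u S ≡ v S)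
           (sq : ∀ x → Square (cong u (glue x)) (cong v (glue x)) hN hS) where

    private
      P : Susp A → Set ℓ
      P z = u z ≡ v z

      sq′ : ∀ x → subst P (glue x) hN ≡ hS
      sq′ x = square→subst u v (glue x) (sq x)

    homotopy : ∀ z → u z ≡ v z
    homotopy = ind P hN hS sq′

    homotopy-N : homotopy N ≡ hN
    homotopy-N = ind-N P hN hS sq′

  -- With definitional β-rules the paths at N and S below are refl.
  module _ {A B C : Set ℓ} (s : B → C) (r : A → B) where

    map-∘-N : map s (map r N) ≡ map (s ∘ r) N
    map-∘-N = trans (trans (cong (map s) (map-N r)) (map-N s)) (sym (map-N (s ∘ r)))

    map-∘-S : map s (map r S) ≡ map (s ∘ r) S
    map-∘-S = trans (trans (cong (map s) (map-S r)) (map-S s)) (sym (map-S (s ∘ r)))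

    map-∘-glue : ∀ x → Square (cong (map s ∘ map r) (glue x))
                              (cong (map (s ∘ r)) (glue x)) map-∘-N map-∘-S
    map-∘-glue x =
      replace-top (cong-∘ (glue x))
        (cong-square (map s) (map-glue r x) ∙v map-glue s (r x))
      ∙v symv (map-glue (s ∘ r) x)

    map-∘ : ∀ z → map s (map r z) ≡ map (s ∘ r) z
    map-∘ = homotopy (map s ∘ map r) (map (s ∘ r)) map-∘-N map-∘-S map-∘-glue

    map-∘-base : trans (cong (map s) (map-N r)) (map-N s) ≡
                 trans (map-∘ N) (map-N (s ∘ r))
    map-∘-base = sym (trans
      (cong (λ t → trans t (map-N (s ∘ r)))
            (homotopy-N (map s ∘ map r) (map (s ∘ r)) map-∘-N map-∘-S map-∘-glue))
      (trans (trans-assoc (trans (cong (map s) (map-N r)) (map-N s)))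
      (trans (cong (trans (trans (cong (map s) (map-N r)) (map-N s)))
                   (trans-symˡ (map-N (s ∘ r))))
             (trans-reflʳ (trans (cong (map s) (map-N r)) (map-N s))))))

  map∗-∘ : {X Y Z : Pointed ℓ} (s : Y →∗ Z) (r : X →∗ Y) →
           map∗ {Y} {Z} s ∘∗ map∗ {X} {Y} r ≡ map∗ {X} {Z} (s ∘∗ r)
  map∗-∘ (s , _) (r , _) = pointed-funext fe (map-∘ s r) (map-∘-base s r)

  module _ (A : Set ℓ) where

    map-id-glue : ∀ x → Square (cong id (glue x)) (cong (map id) (glue x))
                               (sym (map-N {A} id)) (sym (map-S id))
    map-id-glue x = replace-top (cong-id (glue x)) (symv (map-glue id x))

    map-id : ∀ z → z ≡ map id z
    map-id = homotopy id (map id) (sym (map-N id)) (sym (map-S id)) map-id-glue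

    map-id-base : refl ≡ trans (map-id N) (map-N id)
    map-id-base = sym (trans
      (cong (λ t → trans t (map-N id))
            (homotopy-N id (map id) (sym (map-N id)) (sym (map-S id)) map-id-glue))
      (trans-symˡ (map-N id)))

  functor : WildFunctor (𝓤∗ ℓ) (𝓤∗ ℓ)
  functor = record
    { obj     = Susp∗
    ; hom     = λ {X} {Y} → map∗ {X} {Y}
    ; hom-∘   = map∗-∘
    ; hom-idn = λ (A , _) → pointed-funext fe (map-id A) (map-id-base A)
    }

{-# OPTIONS --safe #-}
{-# OPTIONS --without-K #-}

-- Σ is left adjoint to Ω, and a left adjoint L of wild categories preserves colimits
-- as soon as naturality of Hom (L X) Y ≃ Hom X (R Y) in X is coherent with the
-- composition paths of L: transposition then carries postcomposition with L K to
-- postcomposition with K, including the 2-cells, and it is injective on cocones.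
-- The coherence for Σ ⊣ Ω is an equation of 2-paths between pointed maps into a loop
-- space.  Such maps form a retract of the unpointed ones, so the equation may be
-- checked pointwise, where path induction on the β-squares of Σ proves it.

module Submission where

open import Defs
open import Data.Product using (Σ; _,_; proj₁; proj₂)
open import Function.Base using (_∘_; id)
open import Level using (Level; _⊔_)
open import Relation.Binary.PropositionalEquality
  using (_≡_; refl; sym; trans; cong; cong-app; subst; dcong; module ≡-Reasoning)
open import Relation.Binary.PropositionalEquality.Properties
  using (trans-assoc; trans-reflʳ; trans-symˡ; trans-cong; cong-∘)

private
  variable
    a b ℓ o o′ : Level

-- Paths, retracts and equivalences.

Π-ext : FunExt ℓ → {A : Set ℓ} {B : A → Set ℓ} {f g : ∀ x → B x} →
        (∀ x → f x ≡ g x) → f ≡ g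
Π-ext fe {A} {B} {f} {g} = IsEquiv.section (fe A B f g)

trans-cancelˡ : {A : Set a} {x y z : A} (p : x ≡ y) {q r : y ≡ z} →
                trans p q ≡ trans p r → q ≡ r
trans-cancelˡ refl e = e

module _ {A : Set a} {B : Set b} (f : A → B) (r : B → A)
         (H : ∀ x → r (f x) ≡ x) where

  retract-path : {x y : A} (p : x ≡ y) →
                 p ≡ trans (sym (H x)) (trans (cong r (cong f p)) (H y))
  retract-path {x} refl = sym (trans-symˡ (H x))

  cong-injective : {x y : A} {p q : x ≡ y} → cong f p ≡ cong f q → p ≡ q
  cong-injective {x} {y} {p} {q} e =
    trans (retract-path p)
    (trans (cong (λ t → trans (sym (H x)) (trans (cong r t) (H y))) e)
           (sym (retract-path q)))

module _ {A : Set a} {B : Set b} (f : A → B) (g : B → A)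
         (gf : ∀ x → g (f x) ≡ x) (fg : ∀ y → f (g y) ≡ y) where

  lift-path : {x y : A} → f x ≡ f y → x ≡ y
  lift-path {x} {y} u = trans (sym (gf x)) (trans (cong g u) (gf y))

  -- `cong g` is injective because `f` is a left inverse of `g`; under it both sides agree once
  -- conjugated by `gf`.
  cong-lift-path : {x y : A} (u : f x ≡ f y) → cong f (lift-path u) ≡ u
  cong-lift-path {x} {y} u = cong-injective g f fg
    (trans-cancelˡ (sym (gf x)) (trans-cancelʳ (gf y)
      (trans (trans-assoc (sym (gf x)))
      (trans (sym (retract-path f g gf (lift-path u)))
             (sym (trans-assoc (sym (gf x))))))))
    where
    trans-cancelʳ : ∀ {x y z : A} {p q : x ≡ y} (r : y ≡ z) →
                    trans p r ≡ trans q r → p ≡ q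
    trans-cancelʳ {p = p} {q} refl e = trans (sym (trans-reflʳ p)) (trans e (trans-reflʳ q))

  -- The path between first components is lifted along `f`; induction on the lift leaves the
  -- injectivity of the fibre maps.
  Σ-map-injective :
    {P : A → Set o} {Q : B → Set o′} (θ : ∀ x → P x → Q (f x)) →
    (∀ x {p q : P x} → θ x p ≡ θ x q → p ≡ q) →
    {x y : A} {p : P x} {q : P y} →
    _≡_ {A = Σ B Q} (f x , θ x p) (f y , θ y q) → _≡_ {A = Σ A P} (x , p) (y , q)
  Σ-map-injective {P = P} {Q} θ θ-injective e =
    over (lift-path (cong proj₁ e)) (cong-lift-path (cong proj₁ e)) (snd e)
    where
    snd : {s t : Σ B Q} (e : s ≡ t) → subst Q (cong proj₁ e) (proj₂ s) ≡ proj₂ t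
    snd refl = refl

    over : ∀ {x y} {p : P x} {q : P y} (v : x ≡ y) {u : f x ≡ f y} →
           cong f v ≡ u → subst Q u (θ x p) ≡ θ y q →
           _≡_ {A = Σ A P} (x , p) (y , q)
    over refl refl t = cong (_ ,_) (θ-injective _ t)

-- `k` inverts `t ∘ p` on both sides, so `k ∘ t` is a retraction of `p`; injectivity of `t` makes it
-- a section too.
injective-factor : {A : Set a} {B : Set b} {C : Set o} (p : A → B) (t : B → C)
                   (k : C → A) → (∀ {x y} → t x ≡ t y → x ≡ y) →
                   (∀ c → t (p (k c)) ≡ c) → (∀ x → k (t (p x)) ≡ x) → IsEquiv p
injective-factor p t k t-injective section retraction = record
  { section            = k ∘ t
  ; section-inverse    = λ y → t-injective (section (t y))
  ; retraction         = k ∘ t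
  ; retraction-inverse = retraction
  }

-- Equality of cocones.

module _ (fe : FunExt ℓ) {Γ : Graph ℓ} {C : WildCategory o ℓ} (F : Diagram Γ C) where
  open Graph Γ
  open WildCategory C
  private module F = Diagram F

  -- Writing `H` as `cong-app E` allows induction on `E`, after which the comparison of 2-cells is a
  -- pointwise equality up to a unit law.
  cocone-≡ : {X : Obj} {s t : (i : Vertex) → Hom (F.obj i) X}
             {p : ∀ i j e → s j ⊚ F.hom i j e ≡ s i}
             {q : ∀ i j e → t j ⊚ F.hom i j e ≡ t i}
             (H : ∀ i → s i ≡ t i) →
             (∀ i j e → trans (p i j e) (H i) ≡ trans (cong (_⊚ F.hom i j e) (H j)) (q i j e)) →
             _≡_ {A = CoconeOn F X} (s , p) (t , q)
  cocone-≡ {X} {s} {t} {p} {q} H K = along (section H) (section-inverse H) K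
    where
    open IsEquiv (fe Vertex (λ i → Hom (F.obj i) X) s t)

    along : ∀ {t q} (E : s ≡ t) {H : ∀ i → s i ≡ t i} → cong-app E ≡ H →
            (∀ i j e → trans (p i j e) (H i) ≡ trans (cong (_⊚ F.hom i j e) (H j)) (q i j e)) →
            _≡_ {A = CoconeOn F X} (s , p) (t , q)
    along refl refl K =
      cong (s ,_)
        (Π-ext fe λ i → Π-ext fe λ j → Π-ext fe λ e → trans (sym (trans-reflʳ (p i j e))) (K i j e))

-- Left adjoints and colimits.

-- A bare wild adjunction lacks nat-∘, and its left adjoint need not preserve the
-- 2-cells of a cocone.
record CoherentLeftAdjoint {C : WildCategory o ℓ} {D : WildCategory o′ ℓ}
                           (L : WildFunctor C D) : Set (o ⊔ o′ ⊔ ℓ) where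
  private
    module C = WildCategory C
    module D = WildCategory D
    module L = WildFunctor L
  field
    R    : D.Obj → C.Obj
    φ    : ∀ {X Y} → D.Hom (L.obj X) Y → C.Hom X (R Y)
    ψ    : ∀ {X Y} → C.Hom X (R Y) → D.Hom (L.obj X) Y
    ψ-φ  : ∀ {X Y} (f : D.Hom (L.obj X) Y) → ψ (φ f) ≡ f
    φ-ψ  : ∀ {X Y} (k : C.Hom X (R Y)) → φ (ψ k) ≡ k
    nat  : ∀ {X Y Z} (f : D.Hom (L.obj Y) Z) (g : C.Hom X Y) →
           φ f C.⊚ g ≡ φ (f D.⊚ L.hom g)
    nat-∘ : ∀ {W X Y Z} (f : D.Hom (L.obj Y) Z) (g : C.Hom X Y) (k : C.Hom W X) →
            trans (C.assoc (φ f) g k) (nat f (g C.⊚ k)) ≡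
            trans (cong (C._⊚ k) (nat f g))
              (trans (nat (f D.⊚ L.hom g) k)
                (cong φ (trans (D.assoc f (L.hom g) (L.hom k))
                               (cong (f D.⊚_) (L.hom-∘ g k)))))

module _ (fe : FunExt ℓ) {C : WildCategory o ℓ} {D : WildCategory o′ ℓ}
         {L : WildFunctor C D} (adj : CoherentLeftAdjoint L)
         {Γ : Graph ℓ} {F : Diagram Γ C} where
  open Graph Γ
  open CoherentLeftAdjoint adj
  private
    module C = WildCategory C
    module D = WildCategory D
    module L = WildFunctor L
    module F = Diagram F

  transpose : ∀ {Y} → CoconeOn (mapDiagram L F) Y → CoconeOn F (R Y)
  transpose (s , p) =
    φ ∘ s , λ i j e → trans (nat (s j) (F.hom i j e)) (cong φ (p i j e))

  -- On legs `φ` has the inverse `ψ`; on 2-cells `nat` cancels and `cong φ` is injective.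
  transpose-injective : ∀ {Y} {c d : CoconeOn (mapDiagram L F) Y} →
                        transpose c ≡ transpose d → c ≡ d
  transpose-injective {Y} = Σ-map-injective
    {A = ∀ i → D.Hom (L.obj (F.obj i)) Y} {B = ∀ i → C.Hom (F.obj i) (R Y)}
    (λ s i → φ (s i)) (λ t i → ψ (t i))
    (λ s → Π-ext fe λ i → ψ-φ (s i)) (λ t → Π-ext fe λ i → φ-ψ (t i))
    {Q = λ t → ∀ i j e → t j C.⊚ F.hom i j e ≡ t i}
    (λ s p i j e → trans (nat (s j) (F.hom i j e)) (cong φ (p i j e)))
    (λ s E → Π-ext fe λ i → Π-ext fe λ j → Π-ext fe λ e →
      cong-injective φ ψ ψ-φ
        (trans-cancelˡ (nat (s j) (F.hom i j e))
          (cong-app (cong-app (cong-app E i) j) e)))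

  module _ (K : Cocone F) where
    open Cocone K

    -- The legs match by `nat` and the 2-cells by `nat-∘`; this is where the coherence enters.
    transpose-postcompose : ∀ {Y} (f : D.Hom (L.obj tip) Y) →
      postcompose F K (R Y) (φ f) ≡
      transpose (postcompose (mapDiagram L F) (mapCocone L K) Y f)
    transpose-postcompose f =
      cocone-≡ fe F (λ i → nat f (legs i)) (λ i j e → square-at (comm i j e))
      where
      -- The leg `r` is freed from the cocone so that `κ` can be contracted to `refl`.
      square-at : ∀ {X Y} {g : C.Hom Y tip} {k : C.Hom X Y} {r : C.Hom X tip}
                  (κ : g C.⊚ k ≡ r) →
        trans (trans (C.assoc (φ f) g k) (cong (φ f C.⊚_) κ)) (nat f r) ≡
        trans (cong (C._⊚ k) (nat f g))
          (trans (nat (f D.⊚ L.hom g) k)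
            (cong φ (trans (D.assoc f (L.hom g) (L.hom k))
                           (cong (f D.⊚_) (trans (L.hom-∘ g k) (cong L.hom κ))))))
      square-at {g = g} {k} refl
        rewrite trans-reflʳ (C.assoc (φ f) g k) | trans-reflʳ (L.hom-∘ g k) = nat-∘ f g k

    left-adjoint-preserves-colimit :
      IsColimiting F K → IsColimiting (mapDiagram L F) (mapCocone L K)
    left-adjoint-preserves-colimit colim Y =
      -- The inverse transposes a cocone, factors it through the colimit `K`, and transposes back.
      injective-factor (postcompose (mapDiagram L F) (mapCocone L K) Y) transpose
        (ψ ∘ E.retraction) transpose-injective
        (λ c → trans (sym (transpose-postcompose (ψ (E.retraction c))))
                 (trans (cong post (φ-ψ (E.retraction c))) (retraction-section c)))
        (λ f → trans (cong (ψ ∘ E.retraction) (sym (transpose-postcompose f)))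
                 (trans (cong ψ (E.retraction-inverse (φ f))) (ψ-φ f)))
      where
      module E = IsEquiv (colim (R Y))

      post : C.Hom tip (R Y) → CoconeOn F (R Y)
      post = postcompose F K (R Y)

      retraction-section : ∀ c → post (E.retraction c) ≡ c
      retraction-section c =
        trans (cong (post ∘ E.retraction) (sym (E.section-inverse c)))
          (trans (cong post (E.retraction-inverse (E.section c))) (E.section-inverse c))

-- Naturality of transposed loops.

-- Transposition under Σ ⊣ Ω sends (f , f₀) to x ↦ loop f f₀ (glue x₀) (glue x).
loop : {A : Set a} {B : Set b} (f : A → B) {n s : A} {c : B} →
       f n ≡ c → n ≡ s → n ≡ s → c ≡ c
loop f refl refl u = cong f u

loop-base : {A : Set a} {B : Set b} (f : A → B) {n s : A} {c : B}
            (f₀ : f n ≡ c) (u : n ≡ s) → loop f f₀ u u ≡ refl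
loop-base f refl refl = refl

-- Pointwise naturality of transposition: the squares will be the β-squares of `m = map g` at the
-- basepoint and at `x`.
loop-nat : {A : Set a} {B : Set b} {C : Set o} (m : A → B) (f : B → C)
           {n s : A} {n′ s′ : B} {c : C} (mn : m n ≡ n′) (ms : m s ≡ s′) (f₀ : f n′ ≡ c)
           {u₀ u : n ≡ s} {v₀ v : n′ ≡ s′} →
           Square (cong m u₀) v₀ mn ms → Square (cong m u) v mn ms →
           loop f f₀ v₀ v ≡ loop (f ∘ m) (trans (cong f mn) f₀) u₀ u
loop-nat m f refl refl refl {u₀ = refl} {u} (square refl) (square σ) =
  trans (cong (cong f) (trans (sym σ) (trans-reflʳ (cong m u)))) (sym (cong-∘ u))

loop-nat-base : {A : Set a} {B : Set b} {C : Set o} (m : A → B) (f : B → C)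
                {n s : A} {n′ s′ : B} {c : C}
                (mn : m n ≡ n′) (ms : m s ≡ s′) (f₀ : f n′ ≡ c)
                {u : n ≡ s} {v : n′ ≡ s′} (σ : Square (cong m u) v mn ms) →
                loop-base f f₀ v ≡
                trans (loop-nat m f mn ms f₀ σ σ) (loop-base (f ∘ m) (trans (cong f mn) f₀) u)
loop-nat-base m f refl refl refl {refl} (square refl) = refl

-- Pointwise form of `nat-∘` for the raw composite `l ∘ k`, whose squares are pasted from the given
-- ones; the comparison with `map (g ∘ k)` comes later.
loop-nat-∘ : {A B C D : Set ℓ}
  (k : A → B) (l : B → C) (f : C → D) {n s : A} {n′ s′ : B} {n″ s″ : C} {c : D}
  (kn : k n ≡ n′) (ks : k s ≡ s′) (ln : l n′ ≡ n″) (ls : l s′ ≡ s″) (f₀ : f n″ ≡ c)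
  {u₀ u : n ≡ s} {v₀ v : n′ ≡ s′} {w₀ w : n″ ≡ s″}
  (σ₀ : Square (cong k u₀) v₀ kn ks) (σ : Square (cong k u) v kn ks)
  (τ₀ : Square (cong l v₀) w₀ ln ls) (τ : Square (cong l v) w ln ls) →
  loop-nat (l ∘ k) f (trans (cong l kn) ln) (trans (cong l ks) ls) f₀
    (replace-top (cong-∘ u₀) (cong-square l σ₀ ∙v τ₀))
    (replace-top (cong-∘ u) (cong-square l σ ∙v τ)) ≡
  trans (loop-nat l f ln ls f₀ τ₀ τ)
    (trans (loop-nat k (f ∘ l) kn ks (trans (cong f ln) f₀) σ₀ σ)
      (cong (λ b → loop (f ∘ l ∘ k) b u₀ u) (assoc-base f l kn ln f₀)))
loop-nat-∘ k l f refl refl refl refl refl {u₀ = refl} {u} (square refl) (square σ)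
  (square refl) (square τ) = based u σ τ
  where
  -- Contracting `u₀` turns `u` into a loop; freeing its endpoint again permits path induction on
  -- `u`.
  based : ∀ {n s} (u : n ≡ s) {v : k n ≡ k s} {w : l (k n) ≡ l (k s)}
          (σ : trans (cong k u) refl ≡ v) (τ : trans (cong l v) refl ≡ w) →
          trans (cong (cong f) (trans
                  (sym (Square.commutes (replace-top {r = refl} (cong-∘ u)
                    (_∙v_ {s = w} {r′ = refl}
                      (cong-square l {l = refl} {r = refl} (square σ)) (square τ)))))
                  (trans-reflʳ (cong (l ∘ k) u))))
                (sym (cong-∘ u)) ≡
          trans (trans (cong (cong f) (trans (sym τ) (trans-reflʳ (cong l v)))) (sym (cong-∘ v)))
            (trans (trans (cong (cong (f ∘ l)) (trans (sym σ) (trans-reflʳ (cong k u))))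
                          (sym (cong-∘ u)))
                   refl)
  based refl refl refl = refl

-- Homotopies determined by their β-rules.

untranspose : {A : Set a} {x y z : A} {κ : x ≡ y} {p : x ≡ z} {p′ : y ≡ z} →
              p ≡ trans κ p′ → κ ≡ trans p (sym p′)
untranspose {κ = κ} {p} {refl} r =
  trans (sym (trans-reflʳ κ)) (trans (sym r) (sym (trans-reflʳ p)))

-- Definitionally Suspension.map-∘-base when p, p′ and e are the paths at N.
rotate : {A : Set a} {x y z : A} {κ : x ≡ y} (p : x ≡ z) (p′ : y ≡ z) →
         κ ≡ trans p (sym p′) → p ≡ trans κ p′
rotate p p′ e = sym (trans (cong (λ t → trans t p′) e)
  (trans (trans-assoc p) (trans (cong (trans p) (trans-symˡ p′)) (trans-reflʳ p))))

-- Recovers the typal β-rule at a pole from the path that `rotate` builds out of it.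
untranspose-rotate : {A : Set a} {x y z : A} {κ : x ≡ y} (p : x ≡ z) (p′ : y ≡ z)
                     (e : κ ≡ trans p (sym p′)) → untranspose (rotate p p′ e) ≡ e
untranspose-rotate refl refl refl = refl

-- The form in which ind-glue determines Suspension.map-∘.
Pastes : {A : Set a} {B : Set b} {m m′ : A → B} (K : ∀ z → m z ≡ m′ z)
         {n s : A} {n′ s′ : B} {u : n ≡ s} {w : n′ ≡ s′}
         {mn : m n ≡ n′} {ms : m s ≡ s′} {mn′ : m′ n ≡ n′} {ms′ : m′ s ≡ s′} →
         K n ≡ trans mn (sym mn′) → K s ≡ trans ms (sym ms′) →
         Square (cong m u) w mn ms → Square (cong m′ u) w mn′ ms′ → Set b
Pastes {m = m} {m′} K {u = u} en es σ σ′ =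
  trans (dcong K u) es ≡
  trans (cong (subst (λ z → m z ≡ m′ z) u) en) (square→subst m m′ u (σ ∙v symv σ′))

-- For the constant homotopy, the β-rule says that `σ` pasted with the reverse of `σ′` is trivial.
Pastes-refl : {A : Set a} {B : Set b} (m : A → B) {n s : A} (u : n ≡ s) {w : m n ≡ m s}
              (σ σ′ : trans (cong m u) refl ≡ w) →
              Pastes {m = m} {m′ = m} (λ _ → refl) {mn = refl} {refl} {refl} {refl}
                     refl refl (square {l = refl} {r = refl} σ) (square σ′) →
              σ ≡ σ′
Pastes-refl m refl σ refl t =
  cong-injective (λ p → trans p refl) id trans-reflʳ
    (trans (sym (trans-reflʳ _)) (unsym t))
  where
  unsym : {A : Set a} {x : A} {p : x ≡ x} → refl ≡ sym p → p ≡ refl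
  unsym {p = p} e = trans (cong (λ t → trans t p) e) (trans-symˡ p)

loop∘ : {A B C : Set ℓ} (f : B → C) {n s : A} (u₀ u : n ≡ s) {n′ : B} {c : C} →
        f n′ ≡ c → (A , n) →∗ (B , n′) → c ≡ c
loop∘ f u₀ u f₀ (m , m₀) = loop (f ∘ m) (trans (cong f m₀) f₀) u₀ u

-- Carries `loop-nat` from the raw composite of suspended maps to the suspension of the composite.
-- `E` and `β` stand for `funext` and its computation rule; once they are `refl`, `Pastes-refl`
-- identifies the squares.
loop-nat-homotopy : {A B C : Set ℓ} {m m′ : A → B} (f : B → C)
  {n s : A} {n′ s′ : B} {c : C} {u₀ u : n ≡ s} {w₀ w : n′ ≡ s′}
  {mn : m n ≡ n′} {ms : m s ≡ s′} {mn′ : m′ n ≡ n′} {ms′ : m′ s ≡ s′} (f₀ : f n′ ≡ c)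
  (σ₀ : Square (cong m u₀) w₀ mn ms) (σ : Square (cong m u) w mn ms)
  (σ₀′ : Square (cong m′ u₀) w₀ mn′ ms′) (σ′ : Square (cong m′ u) w mn′ ms′)
  (E : m ≡ m′) {K : ∀ z → m z ≡ m′ z} (β : cong-app E ≡ K)
  (rn : mn ≡ trans (K n) mn′) (rs : ms ≡ trans (K s) ms′)
  {en : K n ≡ trans mn (sym mn′)} {es : K s ≡ trans ms (sym ms′)} →
  untranspose rn ≡ en → untranspose rs ≡ es →
  Pastes K en es σ₀ σ₀′ → Pastes K en es σ σ′ →
  trans (loop-nat m f mn ms f₀ σ₀ σ)
    (cong (loop∘ f u₀ u f₀)
      (pointed-≡ E (trans rn (cong (λ H → trans (H n) mn′) (sym β))))) ≡
  loop-nat m′ f mn′ ms′ f₀ σ₀′ σ′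
loop-nat-homotopy {m = m} f {u₀ = u₀} {u} {mn = refl} {refl} f₀ σ₀ σ σ₀′ σ′
  refl refl refl refl refl refl t₀ t
  with refl ← Pastes-refl m u₀ (Square.commutes σ₀) (Square.commutes σ₀′) t₀
     | refl ← Pastes-refl m u (Square.commutes σ) (Square.commutes σ′) t
  = trans-reflʳ _

-- Pointed maps into loop spaces.

module _ (fe : FunExt ℓ) where

  apply : {X Y : Pointed ℓ} → proj₁ X → (X →∗ Y) → proj₁ Y
  apply x (f , _) = f x

  apply-pointed-funext : {X Y : Pointed ℓ} {f g : X →∗ Y} (H : ∀ x → proj₁ f x ≡ proj₁ g x)
    (H₀ : proj₂ f ≡ trans (H (proj₂ X)) (proj₂ g)) (x : proj₁ X) →
    cong (apply {X} {Y} x) (pointed-funext fe {X} {Y} {f} {g} H H₀) ≡ H x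
  apply-pointed-funext {X} {Y} {f} {g} H H₀ x =
    trans (apply-pointed-≡ (funext fe H) _) (cong (λ K → K x) (funext-β fe H))
    where
    apply-pointed-≡ : {f g : proj₁ X → proj₁ Y}
      {f₀ : f (proj₂ X) ≡ proj₂ Y} {g₀ : g (proj₂ X) ≡ proj₂ Y}
      (p : f ≡ g) (q : f₀ ≡ trans (cong-app p (proj₂ X)) g₀) →
      cong (apply {X} {Y} x) (pointed-≡ {X = X} {Y} p q) ≡ cong-app p x
    apply-pointed-≡ refl refl = refl

  Ω : Pointed ℓ → Pointed ℓ
  Ω (_ , y₀) = (y₀ ≡ y₀) , refl

  module _ {X Y : Pointed ℓ} where

    -- Multiplying by the inverse of the value at the basepoint retracts all maps onto the pointed
    -- ones.
    rebase : (proj₁ X → proj₁ (Ω Y)) → X →∗ Ω Y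
    rebase k = (λ x → trans (sym (k (proj₂ X))) (k x)) , trans-symˡ (k (proj₂ X))

    rebase-pointed : (k : X →∗ Ω Y) → rebase (proj₁ k) ≡ k
    rebase-pointed (k , k₀) = pointed-funext fe
      (λ x → cong (λ t → trans (sym t) (k x)) k₀) (base k₀)
      where
      base : ∀ {t : proj₁ (Ω Y)} (t₀ : t ≡ refl) →
             trans-symˡ t ≡ trans (cong (λ q → trans (sym q) t) t₀) t₀
      base refl = refl

    loops-map-≡ : {k l : X →∗ Ω Y} → (∀ x → proj₁ k x ≡ proj₁ l x) → k ≡ l
    loops-map-≡ {k} {l} H =
      trans (sym (rebase-pointed k)) (trans (cong rebase (funext fe H)) (rebase-pointed l))

    -- Pointed maps into a loop space are a retract of all maps, so a 2-path
    -- between them need not respect any basepoint data.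
    loops-map-≡² : {k l : X →∗ Ω Y} {p q : k ≡ l} →
      (∀ x → cong (apply {X} {Ω Y} x) p ≡ cong (apply {X} {Ω Y} x) q) → p ≡ q
    loops-map-≡² {k} {l} {p} {q} H = cong-injective proj₁ rebase rebase-pointed
      (trans (sym (retraction-inverse (cong proj₁ p)))
      (trans (cong retraction (Π-ext fe λ x →
               trans (cong-app-proj₁ p x) (trans (H x) (sym (cong-app-proj₁ q x)))))
             (retraction-inverse (cong proj₁ q))))
      where
      open IsEquiv (fe (proj₁ X) (λ _ → proj₁ (Ω Y)) (proj₁ k) (proj₁ l))

      cong-app-proj₁ : ∀ {k l : X →∗ Ω Y} (p : k ≡ l) x →
                       cong-app (cong proj₁ p) x ≡ cong (apply {X} {Ω Y} x) p
      cong-app-proj₁ refl x = refl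

-- The adjunction Σ ⊣ Ω.

module _ (fe : FunExt ℓ) (su : Suspensions ℓ) where
  open Suspensions su
  open SuspensionRec su
  open Suspension fe su

  φ∗ : {X Y : Pointed ℓ} → Susp∗ X →∗ Y → X →∗ Ω fe Y
  φ∗ {_ , x₀} (f , f₀) = (λ x → loop f f₀ (glue x₀) (glue x)) , loop-base f f₀ (glue x₀)

  ψ∗ : {X Y : Pointed ℓ} → X →∗ Ω fe Y → Susp∗ X →∗ Y
  ψ∗ {Y = _ , y₀} (k , _) = rec y₀ y₀ k , rec-N y₀ y₀ k

  -- `k₀` makes the image of `glue x₀` trivial, so the β-square at `x` leaves `k x`; `loops-map-≡`
  -- supplies the basepoint part.
  φ∗-ψ∗ : {X Y : Pointed ℓ} (k : X →∗ Ω fe Y) → φ∗ {X} {Y} (ψ∗ {X} {Y} k) ≡ k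
  φ∗-ψ∗ {_ , x₀} {_ , y₀} (k , k₀) = loops-map-≡ fe λ x →
    loop-β (rec y₀ y₀ k) (rec-N y₀ y₀ k) k₀ (rec-glue y₀ y₀ k x₀) (rec-glue y₀ y₀ k x)
    where
    loop-β : {A B : Set ℓ} (m : A → B) {n s : A} {c : B} (mn : m n ≡ c) {ms : m s ≡ c}
             {u₀ u : n ≡ s} {v₀ v : c ≡ c} → v₀ ≡ refl →
             Square (cong m u₀) v₀ mn ms → Square (cong m u) v mn ms →
             loop m mn u₀ u ≡ v
    loop-β m refl {u₀ = refl} {u} refl (square refl) (square σ) =
      trans (sym (trans-reflʳ (cong m u))) σ

  ψ∗-φ∗ : {X Y : Pointed ℓ} (f : Susp∗ X →∗ Y) → ψ∗ {X} {Y} (φ∗ {X} {Y} f) ≡ f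
  ψ∗-φ∗ {_ , x₀} {_ , y₀} (f , f₀) = pointed-funext fe
    (homotopy m f hN hS sq) (rotate (rec-N y₀ y₀ k) f₀ (homotopy-N m f hN hS sq))
    where
    k = λ x → loop f f₀ (glue x₀) (glue x)
    m = rec y₀ y₀ k
    hN : m N ≡ f N
    hN = trans (rec-N y₀ y₀ k) (sym f₀)
    -- The last factor, along `f (glue x₀)`, cancels the return along `glue x₀` in `loop`.
    hS : m S ≡ f S
    hS = trans (rec-S y₀ y₀ k) (trans (sym f₀) (cong f (glue x₀)))

    unloop : {A B : Set ℓ} (f : A → B) {n s : A} {x y c : B} (f₀ : f n ≡ c) (u₀ u : n ≡ s)
             {t : x ≡ y} {p : x ≡ c} {q : y ≡ c} → Square t (loop f f₀ u₀ u) p q →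
             Square t (cong f u) (trans p (sym f₀)) (trans q (trans (sym f₀) (cong f u₀)))
    unloop f refl refl u {p = refl} {refl} σ = σ

    sq : ∀ x → Square (cong m (glue x)) (cong f (glue x)) hN hS
    sq x = unloop f f₀ (glue x₀) (glue x) (rec-glue y₀ y₀ k x)

  nat∗-homotopy : {A B : Set ℓ} {Z : Pointed ℓ} (x₀ : A) (f : Susp B → proj₁ Z)
                  (f₀ : f N ≡ proj₂ Z) (g : A → B) (x : A) →
                  loop f f₀ (glue (g x₀)) (glue (g x)) ≡
                  loop (f ∘ map g) (trans (cong f (map-N g)) f₀) (glue x₀) (glue x)
  nat∗-homotopy x₀ f f₀ g x =
    loop-nat (map g) f (map-N g) (map-S g) f₀ (map-glue g x₀) (map-glue g x)

  nat∗ : {X Y Z : Pointed ℓ} (f : Susp∗ Y →∗ Z) (g : X →∗ Y) →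
         _≡_ {A = X →∗ Ω fe Z} (φ∗ {Y} {Z} f ∘∗ g) (φ∗ {X} {Z} (f ∘∗ map∗ {X} {Y} g))
  nat∗ {_ , x₀} {Z = Z} (f , f₀) (g , refl) = pointed-funext fe
    (nat∗-homotopy {Z = Z} x₀ f f₀ g)
    (loop-nat-base (map g) f (map-N g) (map-S g) f₀ (map-glue g x₀))

  -- Evaluated at `x`, the naturality paths become instances of `loop-nat`; `loop-nat-∘` composes
  -- them and `loop-nat-homotopy` passes to `map (g ∘ k)`.
  nat∗-∘ : {W X Y Z : Pointed ℓ} (f : Susp∗ Y →∗ Z) (g : X →∗ Y) (k : W →∗ X) →
    trans (WildCategory.assoc (𝓤∗ ℓ) {W} {X} {Y} {Ω fe Z} (φ∗ {Y} {Z} f) g k)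
          (nat∗ {W} {Y} {Z} f (_∘∗_ {X = W} {X} {Y} g k)) ≡
    trans (cong (λ h → _∘∗_ {X = W} {X} {Ω fe Z} h k) (nat∗ {X} {Y} {Z} f g))
      (trans (nat∗ {W} {X} {Z} (f ∘∗ map∗ {X} {Y} g) k)
        (cong (φ∗ {W} {Z})
          (trans (WildCategory.assoc (𝓤∗ ℓ) {Susp∗ W} {Susp∗ X} {Susp∗ Y} {Z}
                    f (map∗ {X} {Y} g) (map∗ {W} {X} k))
                 (cong (λ h → _∘∗_ {X = Susp∗ W} {Susp∗ Y} {Z} f h) (map∗-∘ {W} {X} {Y} g k)))))
  nat∗-∘ {W@(A , x₀)} {X} {Y} {Z} (f , f₀) (g , refl) (k , refl) = loops-map-≡² fe λ x →
    let open ≡-Reasoning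
        at = apply fe {W} {Ω fe Z} x
        f∗ = f , f₀
        g∗ = g , refl
        k∗ = k , refl
        α = assoc-base f (map g) (map-N k) (map-N g) f₀
        P₁ = cong (λ h → _∘∗_ {X = W} {X} {Ω fe Z} h k∗) (nat∗ {X} {Y} {Z} f∗ g∗)
        P₂ = nat∗ {W} {X} {Z} (f∗ ∘∗ map∗ {X} {Y} g∗) k∗
        P₃ = cong (φ∗ {W} {Z})
               (trans (WildCategory.assoc (𝓤∗ ℓ) {Susp∗ W} {Susp∗ X} {Susp∗ Y} {Z}
                         f∗ (map∗ {X} {Y} g∗) (map∗ {W} {X} k∗))
                      (cong (λ h → _∘∗_ {X = Susp∗ W} {Susp∗ Y} {Z} f∗ h)
                            (map∗-∘ {W} {X} {Y} g∗ k∗)))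
        H₁ = nat∗-homotopy {Z = Z} (k x₀) f f₀ g (k x)
        H₂ = nat∗-homotopy {Z = Z} x₀ (f ∘ map g) (trans (cong f (map-N g)) f₀) k x
        H₃ = cong (λ b → loop (f ∘ map g ∘ map k) b (glue x₀) (glue x)) α
        H₄ = cong (loop∘ f (glue x₀) (glue x) f₀) (map∗-∘ {W} {X} {Y} g∗ k∗)
        e₁ : cong at P₁ ≡ H₁
        e₁ = trans (sym (cong-∘ (nat∗ {X} {Y} {Z} f∗ g∗)))
                   (apply-pointed-funext fe _ _ (k x))
        e₂ : cong at P₂ ≡ H₂
        e₂ = apply-pointed-funext fe _ _ x
        e₃ : cong at P₃ ≡ trans H₃ H₄
        e₃ = apply-φ∗ x α (map∗-∘ {W} {X} {Y} g∗ k∗)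
        H = nat∗-homotopy {Z = Z} x₀ f f₀ (g ∘ k) x
    in begin
      cong at (trans (WildCategory.assoc (𝓤∗ ℓ) {W} {X} {Y} {Ω fe Z} (φ∗ {Y} {Z} f∗) g∗ k∗)
                     (nat∗ {W} {Y} {Z} f∗ (_∘∗_ {X = W} {X} {Y} g∗ k∗)))
        ≡⟨ apply-assoc x _ _ ⟩
      cong at (nat∗ {W} {Y} {Z} f∗ (_∘∗_ {X = W} {X} {Y} g∗ k∗))
        ≡⟨ apply-pointed-funext fe _ _ x ⟩
      H
        ≡⟨ loop-nat-homotopy f f₀
             (σ g k x₀) (σ g k x) (map-glue (g ∘ k) x₀) (map-glue (g ∘ k) x)
             (funext fe (map-∘ g k)) (funext-β fe (map-∘ g k))
             -- `map-∘-base` is already a rotation of the β-path at `N`; the same rotation is formed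
             -- at `S`.
             (map-∘-base g k) (rotate _ _ (ind-S _ _ _ _))
             (untranspose-rotate (trans (cong (map g) (map-N k)) (map-N g)) (map-N (g ∘ k)) _)
             (untranspose-rotate (trans (cong (map g) (map-S k)) (map-S g)) (map-S (g ∘ k)) _)
             -- The β-rule of `map-∘` on `glue` is exactly the pasting condition.
             (ind-glue _ _ _ _ x₀) (ind-glue _ _ _ _ x) ⟨
      trans (loop-nat (map g ∘ map k) f _ _ f₀ (σ g k x₀) (σ g k x)) H₄
        ≡⟨ cong (λ t → trans t H₄)
             (loop-nat-∘ (map k) (map g) f _ _ _ _ f₀ (map-glue k x₀) (map-glue k x)
               (map-glue g (k x₀)) (map-glue g (k x))) ⟩
      trans (trans H₁ (trans H₂ H₃)) H₄
        ≡⟨ trans (trans-assoc H₁) (cong (trans H₁) (trans-assoc H₂)) ⟩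
      trans H₁ (trans H₂ (trans H₃ H₄))
        ≡⟨ cong₃ e₁ e₂ e₃ ⟨
      trans (cong at P₁) (trans (cong at P₂) (cong at P₃))
        ≡⟨ trans (cong (trans _) (trans-cong {f = at} P₂)) (trans-cong {f = at} P₁) ⟩
      cong at (trans P₁ (trans P₂ P₃))
        ∎
    where
    -- The square that `map-∘-glue` pastes with the reversed β-square of the composite.
    σ : {A B C : Set ℓ} (g : B → C) (k : A → B) (x : A) → Square _ _ _ _
    σ g k x = replace-top (cong-∘ (glue x))
                (cong-square (map g) (map-glue k x) ∙v map-glue g (k x))

    cong₃ : {B : Set ℓ} {x y z w : B} {p p′ : x ≡ y} {q q′ : y ≡ z} {r r′ : z ≡ w} →
            p ≡ p′ → q ≡ q′ → r ≡ r′ → trans p (trans q r) ≡ trans p′ (trans q′ r′)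
    cong₃ refl refl refl = refl

    -- Associativity changes only the basepoint component, which evaluation forgets.
    apply-assoc : ∀ x {h : A → proj₁ (Ω fe Z)} {b b′ : h x₀ ≡ refl} (e : b ≡ b′)
                  {l : W →∗ Ω fe Z} (p : (h , b′) ≡ l) →
                  cong (apply fe {W} {Ω fe Z} x) (trans (cong (h ,_) e) p) ≡
                  cong (apply fe {W} {Ω fe Z} x) p
    apply-assoc x refl p = refl

    -- Under `φ∗` associativity stays visible, since the loop depends on the basepoint path `b`.
    apply-φ∗ : ∀ x {m m′ : Susp∗ W →∗ Susp∗ Y} {b : f (proj₁ m N) ≡ proj₂ Z}
      (α : b ≡ trans (cong f (proj₂ m)) f₀) (μ : m ≡ m′) →
      cong (apply fe {W} {Ω fe Z} x) (cong (φ∗ {W} {Z})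
        (trans (cong ((f ∘ proj₁ m) ,_) α)
               (cong (λ h → _∘∗_ {X = Susp∗ W} {Susp∗ Y} {Z} (f , f₀) h) μ))) ≡
      trans (cong (λ b → loop (f ∘ proj₁ m) b (glue x₀) (glue x)) α)
            (cong (loop∘ f (glue x₀) (glue x) f₀) μ)
    apply-φ∗ x refl refl = refl

  suspension-adjoint : CoherentLeftAdjoint functor
  suspension-adjoint = record
    { R     = Ω fe
    ; φ     = λ {X} {Y} → φ∗ {X} {Y}
    ; ψ     = λ {X} {Y} → ψ∗ {X} {Y}
    ; ψ-φ   = λ {X} {Y} → ψ∗-φ∗ {X} {Y}
    ; φ-ψ   = λ {X} {Y} → φ∗-ψ∗ {X} {Y}
    ; nat   = λ {X} {Y} {Z} → nat∗ {X} {Y} {Z}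
    ; nat-∘ = λ {W} {X} {Y} {Z} → nat∗-∘ {W} {X} {Y} {Z}
    }

theorem6p4 : {ℓ : Level} (fe : FunExt ℓ) (su : Suspensions ℓ)
    (Γ : Graph ℓ) (F : Diagram Γ (𝓤∗ ℓ)) (K : Cocone F) →
    IsColimiting F K →
    IsColimiting (mapDiagram (Suspension.functor fe su) F)
    (mapCocone (Suspension.functor fe su) K)
theorem6p4 fe su Γ F K = left-adjoint-preserves-colimit fe (suspension-adjoint fe su) K
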